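{- Suppose $m\in\omega$ and $0<\delta<\varepsilon<1$. There exists $n\in\omega$ such that for every finite set $I\subseteq\omega$ with $|I|>n$ there exists a set $C\subseteq 2^I$ such that $1-\varepsilon+\delta\geq |C|\cdot 2^{ -|I|}\geq 1-\varepsilon-\delta$ and for every set $X\subseteq 2^I$ with $|X|\leq m$, $$\left|\frac{\left|\bigcap_{s\in X}(C+s)\right|}{2^{|I|}} - (1-\varepsilon)^{|X|}\right|<\delta.$$
   Context: For a finite set $I\subseteq\omega$, $2^I$ is the set of functions $I\to\{0,1\}$, a group under coordinatewise addition mod 2; $C+s=\{c+s:c\in C\}$. The empty intersection $\bigcap_{s\in\emptyset}(C+s)$ is understood as $2^I$.
   Formalization: The parameters ε and δ are taken to be rational numbers instead of arbitrary real numbers. -}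

module Defs where

import Data.Bool
open import Data.Bool using (Bool; true; false; _xor_; if_then_else_)
open import Data.Nat as ℕ using (ℕ; zero; suc)
open import Data.Nat.Properties using (m^n≢0)
open import Data.Integer using (+_)
open import Data.Vec using (Vec; []; _∷_; zipWith; map; _++_)
open import Data.List as List using (List; filter; length)
open import Data.Rational using (ℚ; _/_; _*_; 1ℚ)
open import Relation.Nullary.Decidable using (does)
open import Data.Bool.Properties using (T?)

-- 2^I, for |I| = k, modelled as Bool-vectors of length k (coordinates indexed by
-- an enumeration of I); addition mod 2 is coordinatewise xor.
Cube : ℕ → Set
Cube k = Vec Bool k

_⊕_ : ∀ {k} → Cube k → Cube k → Cube k
_⊕_ = zipWith _xor_

allCube : (k : ℕ) → List (Cube k)
allCube zero = [] List.∷ List.[]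
allCube (suc k) = List.map (false ∷_) (allCube k) List.++ List.map (true ∷_) (allCube k)

Subset2 : ℕ → Set
Subset2 k = Cube k → Bool

card : ∀ {k} → Subset2 k → ℕ
card {k} C = length (filter (λ v → T? (C v)) (allCube k))

-- membership in the translate C + s = { c + s : c ∈ C }:  v ∈ C + s  iff  v + s ∈ C
translate : ∀ {k} → Subset2 k → Cube k → Subset2 k
translate C s v = C (v ⊕ s)

bigInter : ∀ {k} → Subset2 k → List (Cube k) → Subset2 k
bigInter C X v = allB X
  where
  allB : List _ → Bool
  allB List.[] = true
  allB (s List.∷ ss) = translate C s v Data.Bool.∧ allB ss

density : ∀ {k} → Subset2 k → ℚ
density {k} A = (+ card A) / (2 ℕ.^ k) where instance _ = m^n≢0 2 k

_^ℚ_ : ℚ → ℕ → ℚ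
q ^ℚ zero = 1ℚ
q ^ℚ suc n = q * (q ^ℚ n)

{-# OPTIONS --safe #-}
module Submission where

-- C is found by derandomizing a random set containing each point independently with probability
-- p = 1 − ε. The points are decided one at a time; an undecided point carries weight p. For
-- distinct translates, the expected size of the intersection is a martingale during this process,
-- and deciding one point moves it by at most |X|. With D its deviation from 2^k p^|X|, t the
-- number of undecided points and L large enough, the energy (D² + t L)^r, summed over all short X,
-- is a supermartingale, so each point can be decided without increasing the sum. Initially the
-- sum is at most (2N)^M (N L)^r with N = 2^k, whereas a deviation δN costs (δN)^(2r) at the end;
-- for r = M + 1 this is impossible once N is large.

open import Defs
open import Data.Nat as ℕ using (ℕ; zero; suc)
import Data.Nat.Properties as ℕ
open import Data.Nat.Coprimality using (1-coprimeTo) renaming (sym to coprime-sym)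
import Data.Integer as ℤ
import Data.Integer.Properties as ℤ
open import Data.Vec using ([]; _∷_; head; replicate)
open import Data.Vec.Properties using (≡-dec; ∷-injectiveʳ; zipWith-identityʳ)
open import Data.Bool using (Bool; true; false; T; _∧_; _xor_)
open import Data.Bool.Properties using (T?; not-injective; xor-identityʳ; ∧-identityʳ) renaming (_≟_ to _≟ᵇ_)
open import Data.List using (List; []; _∷_; _++_; length; map; filter; cartesianProductWith)
open import Data.List.Properties using (length-map; length-++; length-filter; filter-≐)
open import Data.List.Membership.Propositional using (_∈_)
open import Data.List.Membership.Propositional.Properties
open import Data.List.Relation.Unary.All as All using (All; []; _∷_)
open import Data.List.Relation.Unary.All.Properties using (all-filter)
open import Data.List.Relation.Unary.AllPairs using ([]; _∷_)
open import Data.List.Relation.Unary.Any using (here; there)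
import Data.List.Relation.Unary.Unique.DecPropositional as DecUnique
open import Data.List.Relation.Unary.Unique.Propositional using (Unique)
open import Data.List.Relation.Unary.Unique.Propositional.Properties using (map⁺; ++⁺)
open import Data.Rational using (ℚ; mkℚ; 0ℚ; 1ℚ; _<_; _≤_; _+_; _-_; -_; _*_; _/_; 1/_; ∣_∣; *≤*; nonNegative; positive; toℚᵘ)
open import Data.Rational.Properties hiding (_≟_)
open import Data.Rational.Solver using (module +-*-Solver)
open import Data.Rational.Unnormalised as ℚᵘ using (mkℚᵘ)
import Data.Rational.Unnormalised.Properties as ℚᵘ
open import Data.Product using (∃; _×_; _,_; proj₁; proj₂)
open import Data.Sum using (_⊎_; inj₁; inj₂)
open import Function using (_∘_)
open import Relation.Nullary using (¬_; Dec; yes; no; does; contradiction)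
open import Relation.Nullary.Decidable using (_×-dec_)
open import Relation.Binary.PropositionalEquality
open +-*-Solver using (solve; _:=_; _:+_; _:*_; _:-_; :-_; con)

-- Naturals inside the rationals, order and powers

-- Defined by recursion so that the successor unfolds to adding 1, which is what the sums and
-- inductions use; `ι≡mkℚ` links it to normalised fractions.
ι : ℕ → ℚ
ι zero    = 0ℚ
ι (suc n) = 1ℚ + ι n

2ℚ : ℚ
2ℚ = 1ℚ + 1ℚ

0≤1 : 0ℚ ≤ 1ℚ
0≤1 = nonNegative⁻¹ 1ℚ

0≤2 : 0ℚ ≤ 2ℚ
0≤2 = nonNegative⁻¹ 2ℚ

0≤+ : ∀ {a b} → 0ℚ ≤ a → 0ℚ ≤ b → 0ℚ ≤ a + b
0≤+ = +-mono-≤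

0≤* : ∀ {a b} → 0ℚ ≤ a → 0ℚ ≤ b → 0ℚ ≤ a * b
0≤* {a} {b} 0≤a 0≤b =
  subst (_≤ a * b) (*-zeroʳ a) (*-monoˡ-≤-nonNeg a {{nonNegative 0≤a}} 0≤b)

∣a∣*∣a∣≡a*a : ∀ a → ∣ a ∣ * ∣ a ∣ ≡ a * a
∣a∣*∣a∣≡a*a a with ∣p∣≡p∨∣p∣≡-p a
... | inj₁ e rewrite e = refl
... | inj₂ e rewrite e = solve 1 (λ x → (:- x) :* (:- x) := x :* x) refl a

0≤square : ∀ a → 0ℚ ≤ a * a
0≤square a = subst (0ℚ ≤_) (∣a∣*∣a∣≡a*a a) (0≤* (0≤∣p∣ a) (0≤∣p∣ a))

*-mono₂-≤ : ∀ {a b c d} → 0ℚ ≤ b → 0ℚ ≤ c → a ≤ b → c ≤ d → a * c ≤ b * d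
*-mono₂-≤ {a} {b} {c} 0≤b 0≤c a≤b c≤d = ≤-trans
  (*-monoʳ-≤-nonNeg c {{nonNegative 0≤c}} a≤b) (*-monoˡ-≤-nonNeg b {{nonNegative 0≤b}} c≤d)

a≤a+b : ∀ {a b} → 0ℚ ≤ b → a ≤ a + b
a≤a+b {a} {b} 0≤b = subst (_≤ a + b) (+-identityʳ a) (+-monoʳ-≤ a 0≤b)

scale-≤ : ∀ {c a b} → 0ℚ ≤ c → c ≤ 1ℚ → 0ℚ ≤ b → a ≤ b → c * a ≤ b
scale-≤ {c} {a} {b} 0≤c c≤1 0≤b a≤b = ≤-trans (*-monoˡ-≤-nonNeg c {{nonNegative 0≤c}} a≤b)
  (subst (c * b ≤_) (*-identityˡ b) (*-monoʳ-≤-nonNeg b {{nonNegative 0≤b}} c≤1))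

a≤b⇒0≤b-a : ∀ {a b} → a ≤ b → 0ℚ ≤ b - a
a≤b⇒0≤b-a {a} {b} a≤b = subst (_≤ b - a) (+-inverseʳ a) (+-monoˡ-≤ (- a) a≤b)

0≤b-a⇒a≤b : ∀ {a b} → 0ℚ ≤ b - a → a ≤ b
0≤b-a⇒a≤b {a} {b} h = subst (a ≤_) (solve 2 (λ a b → a :+ (b :- a) := b) refl a b) (a≤a+b h)

^-nonNeg : ∀ r {a} → 0ℚ ≤ a → 0ℚ ≤ a ^ℚ r
^-nonNeg zero    _   = 0≤1
^-nonNeg (suc r) 0≤a = 0≤* 0≤a (^-nonNeg r 0≤a)

^-mono-≤ : ∀ r {a b} → 0ℚ ≤ a → a ≤ b → a ^ℚ r ≤ b ^ℚ r
^-mono-≤ zero    _   _   = ≤-refl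
^-mono-≤ (suc r) 0≤a a≤b = *-mono₂-≤ (≤-trans 0≤a a≤b) (^-nonNeg r 0≤a) a≤b (^-mono-≤ r 0≤a a≤b)

^-distrib-* : ∀ r a b → (a * b) ^ℚ r ≡ a ^ℚ r * b ^ℚ r
^-distrib-* zero    a b = sym (*-identityˡ 1ℚ)
^-distrib-* (suc r) a b = trans (cong (a * b *_) (^-distrib-* r a b))
  (solve 4 (λ a b c d → (a :* b) :* (c :* d) := (a :* c) :* (b :* d)) refl a b (a ^ℚ r) (b ^ℚ r))

ι-nonNeg : ∀ n → 0ℚ ≤ ι n
ι-nonNeg zero    = ≤-refl
ι-nonNeg (suc n) = 0≤+ 0≤1 (ι-nonNeg n)

ι-mono-≤ : ∀ {m n} → m ℕ.≤ n → ι m ≤ ι n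
ι-mono-≤ {n = n} ℕ.z≤n = ι-nonNeg n
ι-mono-≤ (ℕ.s≤s m≤n)   = +-monoʳ-≤ 1ℚ (ι-mono-≤ m≤n)

0<* : ∀ {a b} → 0ℚ < a → 0ℚ < b → 0ℚ < a * b
0<* {a} {b} 0<a 0<b =
  positive⁻¹ (a * b) {{pos*pos⇒pos a {{positive 0<a}} b {{positive 0<b}}}}

^-pos : ∀ r {a} → 0ℚ < a → 0ℚ < a ^ℚ r
^-pos zero    _   = positive⁻¹ 1ℚ
^-pos (suc r) 0<a = 0<* 0<a (^-pos r 0<a)

-- Moments of a single biased coin flip

-- A discrete mean value estimate: morally the slope is at most r A^(r-1), and the hypothesis trades
-- (a - b)² for K A. The factor a - b is kept because this product is the covariance term of
-- `power-step`.
^-slope-≤ : ∀ r {a b A K} → 0ℚ ≤ a → 0ℚ ≤ b → a ≤ A → b ≤ A → 0ℚ ≤ K →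
  (a - b) * (a - b) ≤ K * A → (a ^ℚ r - b ^ℚ r) * (a - b) ≤ ι r * K * A ^ℚ r
^-slope-≤ zero {a} {b} {A} {K} _ _ _ _ _ _ = ≤-reflexive
  (solve 3 (λ a b K → (con 1ℚ :- con 1ℚ) :* (a :- b) := con 0ℚ :* K :* con 1ℚ) refl a b K)
^-slope-≤ (suc r) {a} {b} {A} {K} 0≤a 0≤b a≤A b≤A 0≤K h = begin
  (a * aʳ - b * bʳ) * (a - b)
    ≡⟨ solve 4 (λ a b x y → (a :* x :- b :* y) :* (a :- b) :=
         a :* ((x :- y) :* (a :- b)) :+ ((a :- b) :* (a :- b)) :* y) refl a b aʳ bʳ ⟩
  a * ((aʳ - bʳ) * (a - b)) + (a - b) * (a - b) * bʳ
    ≤⟨ +-mono-≤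
         (≤-trans (*-monoˡ-≤-nonNeg a {{nonNegative 0≤a}} (^-slope-≤ r 0≤a 0≤b a≤A b≤A 0≤K h))
                  (*-monoʳ-≤-nonNeg (ι r * K * A ^ℚ r) {{nonNegative 0≤B}} a≤A))
         (*-mono₂-≤ (0≤* 0≤K 0≤A) (^-nonNeg r 0≤b) h (^-mono-≤ r 0≤b b≤A)) ⟩
  A * (ι r * K * A ^ℚ r) + K * A * A ^ℚ r
    ≡⟨ solve 4 (λ A r K X → A :* (r :* K :* X) :+ K :* A :* X :=
         (con 1ℚ :+ r) :* K :* (A :* X)) refl A (ι r) K (A ^ℚ r) ⟩
  (1ℚ + ι r) * K * (A * A ^ℚ r) ∎
  where
  open ≤-Reasoning
  aʳ = a ^ℚ r
  bʳ = b ^ℚ r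
  0≤A = ≤-trans 0≤a a≤A
  0≤B = 0≤* (0≤* (ι-nonNeg r) 0≤K) (^-nonNeg r 0≤A)

-- The increment of the constant L pays for the covariance term in the induction of power-step.
growth : ℕ → ℚ → ℚ
growth zero    μ = μ
growth (suc r) μ = growth r μ + ι r * (2ℚ * 2ℚ * μ) * 2ℚ ^ℚ r

module Step (p : ℚ) (0≤p : 0ℚ ≤ p) (p≤1 : p ≤ 1ℚ) where

  q : ℚ
  q = 1ℚ - p

  0≤q : 0ℚ ≤ q
  0≤q = a≤b⇒0≤b-a p≤1

  q≤1 : q ≤ 1ℚ
  q≤1 = 0≤b-a⇒a≤b (subst (0ℚ ≤_) (solve 1 (λ p → p := con 1ℚ :- (con 1ℚ :- p)) refl p) 0≤p)

  -- The expectation of a variable worth x with probability p and y with probability q.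
  mean : ℚ → ℚ → ℚ
  mean x y = p * x + q * y

  -- In the application x and y are the deviations after putting a point into C or leaving it out, Y
  -- is the allowance of the points still open, and μ bounds the squared effect of one decision.
  module _ (x y Y μ : ℚ) (0≤Y : 0ℚ ≤ Y) (0≤μ : 0ℚ ≤ μ) (small : (x - y) * (x - y) ≤ μ) where

    private
      D = mean x y
      Z = D * D + Y
      a = x * x + Y
      b = y * y + Y
      A = 2ℚ * (Z + μ)
      K = 2ℚ * 2ℚ * μ

      0≤a : 0ℚ ≤ a
      0≤a = 0≤+ (0≤square x) 0≤Y
      0≤b : 0ℚ ≤ b
      0≤b = 0≤+ (0≤square y) 0≤Y
      0≤Z : 0ℚ ≤ Z
      0≤Z = 0≤+ (0≤square D) 0≤Y
      0≤K : 0ℚ ≤ K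
      0≤K = 0≤* (0≤* 0≤2 0≤2) 0≤μ

      -- Second moment as squared mean plus variance: the variance is p q (x - y)², hence at most μ.
      mean-a-b : mean a b ≤ Z + μ
      mean-a-b = begin
        p * a + q * b
          ≡⟨ solve 4 (λ x y Y p → let q = con 1ℚ :- p ; D = p :* x :+ q :* y in
               p :* (x :* x :+ Y) :+ q :* (y :* y :+ Y) :=
               D :* D :+ Y :+ p :* (q :* ((x :- y) :* (x :- y)))) refl x y Y p ⟩
        Z + p * (q * ((x - y) * (x - y)))
          ≤⟨ +-monoʳ-≤ Z (scale-≤ 0≤p p≤1 0≤μ (scale-≤ 0≤q q≤1 0≤μ small)) ⟩
        Z + μ ∎
        where open ≤-Reasoning

      -- u² ≤ 2D² + 2(u - D)², the difference being (u - 2D)²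
      near : ∀ u → (u - D) * (u - D) ≤ μ → u * u + Y ≤ A
      near u h = begin
        u * u + Y
          ≤⟨ a≤a+b (0≤+ (0≤square (u - 2ℚ * D)) 0≤Y) ⟩
        u * u + Y + ((u - 2ℚ * D) * (u - 2ℚ * D) + Y)
          ≡⟨ solve 3 (λ u D Y → u :* u :+ Y :+ ((u :- con 2ℚ :* D) :* (u :- con 2ℚ :* D) :+ Y) :=
               con 2ℚ :* (D :* D :+ Y :+ (u :- D) :* (u :- D))) refl u D Y ⟩
        2ℚ * (Z + (u - D) * (u - D))
          ≤⟨ *-monoˡ-≤-nonNeg 2ℚ (+-monoʳ-≤ Z h) ⟩
        A ∎
        where open ≤-Reasoning

      -- The distance from the mean is x - D = q (x - y); for `b≤A` it is y - D = p (y - x).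
      a≤A : a ≤ A
      a≤A = near x (subst (_≤ μ)
        (solve 3 (λ x y p → let q = con 1ℚ :- p ; e = x :- (p :* x :+ q :* y) in
          q :* (q :* ((x :- y) :* (x :- y))) := e :* e) refl x y p)
        (scale-≤ 0≤q q≤1 0≤μ (scale-≤ 0≤q q≤1 0≤μ small)))

      b≤A : b ≤ A
      b≤A = near y (subst (_≤ μ)
        (solve 3 (λ x y p → let q = con 1ℚ :- p ; e = y :- (p :* x :+ q :* y) in
          p :* (p :* ((x :- y) :* (x :- y))) := e :* e) refl x y p)
        (scale-≤ 0≤p p≤1 0≤μ (scale-≤ 0≤p p≤1 0≤μ small)))

      -- Y cancels and x² - y² = (x - y)(x + y). The second factor squared is at most 2 (a + b) ≤ 4
      -- A, which gives the 4 in `K`.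
      a-b-small : (a - b) * (a - b) ≤ K * A
      a-b-small = begin
        (a - b) * (a - b)
          ≡⟨ solve 3 (λ x y Y → let e = x :* x :+ Y :- (y :* y :+ Y) in e :* e :=
               ((x :- y) :* (x :- y)) :* ((x :+ y) :* (x :+ y))) refl x y Y ⟩
        (x - y) * (x - y) * ((x + y) * (x + y))
          ≤⟨ *-mono₂-≤ 0≤μ (0≤square (x + y)) small sum≤ ⟩
        μ * (2ℚ * (A + A))
          ≡⟨ solve 2 (λ m A → m :* (con 2ℚ :* (A :+ A)) := con 2ℚ :* con 2ℚ :* m :* A) refl μ A ⟩
        K * A ∎
        where
        open ≤-Reasoning
        sum≤ : (x + y) * (x + y) ≤ 2ℚ * (A + A)
        sum≤ = begin
          (x + y) * (x + y)
            ≤⟨ a≤a+b (0≤+ (0≤square (x - y)) (0≤* (0≤* 0≤2 0≤2) 0≤Y)) ⟩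
          (x + y) * (x + y) + ((x - y) * (x - y) + 2ℚ * 2ℚ * Y)
            ≡⟨ solve 3 (λ x y Y → (x :+ y) :* (x :+ y) :+ ((x :- y) :* (x :- y) :+ con 2ℚ :* con 2ℚ :* Y) :=
                 con 2ℚ :* (x :* x :+ Y :+ (y :* y :+ Y))) refl x y Y ⟩
          2ℚ * (a + b)
            ≤⟨ *-monoˡ-≤-nonNeg 2ℚ (+-mono-≤ a≤A b≤A) ⟩
          2ℚ * (A + A) ∎

    μ≤growth : ∀ r → μ ≤ growth r μ
    μ≤growth zero    = ≤-refl
    μ≤growth (suc r) = ≤-trans (μ≤growth r)
      (a≤a+b (0≤* (0≤* (ι-nonNeg r) 0≤K) (^-nonNeg r 0≤2)))

    power-step : ∀ r → mean (a ^ℚ r) (b ^ℚ r) ≤ (Z + growth r μ) ^ℚ r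
    power-step zero    = ≤-reflexive
      (solve 1 (λ p → p :* con 1ℚ :+ (con 1ℚ :- p) :* con 1ℚ := con 1ℚ) refl p)
    -- E[uv] = E[u] E[v] + p q (u₁ - u₀)(v₁ - v₀) for two-valued u, v
    power-step (suc r) = begin
      mean (a * aʳ) (b * bʳ)
        ≡⟨ solve 5 (λ a b u v p → let q = con 1ℚ :- p in
             p :* (a :* u) :+ q :* (b :* v) :=
             (p :* u :+ q :* v) :* (p :* a :+ q :* b) :+ p :* (q :* ((u :- v) :* (a :- b))))
             refl a b aʳ bʳ p ⟩
      mean aʳ bʳ * mean a b + p * (q * ((aʳ - bʳ) * (a - b)))
        ≤⟨ +-mono-≤
             (*-mono₂-≤ 0≤Sʳ (0≤+ (0≤* 0≤p 0≤a) (0≤* 0≤q 0≤b)) (power-step r)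
               (≤-trans mean-a-b Z+μ≤S))
             (scale-≤ 0≤p p≤1 0≤E (scale-≤ 0≤q q≤1 0≤E
               (≤-trans (^-slope-≤ r 0≤a 0≤b a≤A b≤A 0≤K a-b-small) slope≤E))) ⟩
      S ^ℚ r * S + E
        ≡⟨ solve 4 (λ Z g c X → X :* (Z :+ g) :+ c :* X := (Z :+ (g :+ c)) :* X) refl
             Z (growth r μ) (ι r * K * 2ℚ ^ℚ r) (S ^ℚ r) ⟩
      S′ * S ^ℚ r
        ≤⟨ *-monoˡ-≤-nonNeg S′ {{nonNegative (≤-trans 0≤S S≤S′)}} (^-mono-≤ r 0≤S S≤S′) ⟩
      S′ * S′ ^ℚ r ∎
      where
      open ≤-Reasoning
      aʳ = a ^ℚ r
      bʳ = b ^ℚ r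
      S  = Z + growth r μ
      S′ = Z + growth (suc r) μ
      E  = ι r * K * 2ℚ ^ℚ r * S ^ℚ r
      Z+μ≤S : Z + μ ≤ S
      Z+μ≤S = +-monoʳ-≤ Z (μ≤growth r)
      0≤S : 0ℚ ≤ S
      0≤S = ≤-trans (0≤+ 0≤Z 0≤μ) Z+μ≤S
      0≤Sʳ : 0ℚ ≤ S ^ℚ r
      0≤Sʳ = ^-nonNeg r 0≤S
      0≤c : 0ℚ ≤ ι r * K * 2ℚ ^ℚ r
      0≤c = 0≤* (0≤* (ι-nonNeg r) 0≤K) (^-nonNeg r 0≤2)
      S≤S′ : S ≤ S′
      S≤S′ = +-monoʳ-≤ Z (a≤a+b 0≤c)
      0≤E : 0ℚ ≤ E
      0≤E = 0≤* 0≤c 0≤Sʳ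
      slope≤E : ι r * K * A ^ℚ r ≤ E
      -- Since A is twice Z + μ, its r-th power produces the factor 2^r in `growth`.
      slope≤E = begin
        ι r * K * A ^ℚ r
          ≡⟨ cong (ι r * K *_) (^-distrib-* r 2ℚ (Z + μ)) ⟩
        ι r * K * (2ℚ ^ℚ r * (Z + μ) ^ℚ r)
          ≡⟨ sym (*-assoc (ι r * K) (2ℚ ^ℚ r) ((Z + μ) ^ℚ r)) ⟩
        ι r * K * 2ℚ ^ℚ r * (Z + μ) ^ℚ r
          ≤⟨ *-monoˡ-≤-nonNeg (ι r * K * 2ℚ ^ℚ r) {{nonNegative 0≤c}} (^-mono-≤ r (0≤+ 0≤Z 0≤μ) Z+μ≤S) ⟩
        E ∎

-- Finite sums over lists

∑ : ∀ {A : Set} → (A → ℚ) → List A → ℚ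
∑ f []       = 0ℚ
∑ f (x ∷ xs) = f x + ∑ f xs

module _ {A : Set} where

  ∑-cong : ∀ {f g : A → ℚ} → (∀ x → f x ≡ g x) → ∀ xs → ∑ f xs ≡ ∑ g xs
  ∑-cong h []       = refl
  ∑-cong h (x ∷ xs) = cong₂ _+_ (h x) (∑-cong h xs)

  ∑-mono-All : ∀ {f g : A → ℚ} {xs} → All (λ x → f x ≤ g x) xs → ∑ f xs ≤ ∑ g xs
  ∑-mono-All []       = ≤-refl
  ∑-mono-All (h ∷ hs) = +-mono-≤ h (∑-mono-All hs)

  ∑-mono : ∀ {f g : A → ℚ} → (∀ x → f x ≤ g x) → ∀ xs → ∑ f xs ≤ ∑ g xs
  ∑-mono h []       = ≤-refl
  ∑-mono h (x ∷ xs) = +-mono-≤ (h x) (∑-mono h xs)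

  ∑-+ : ∀ (f g : A → ℚ) xs → ∑ (λ x → f x + g x) xs ≡ ∑ f xs + ∑ g xs
  ∑-+ f g []       = sym (+-identityʳ 0ℚ)
  ∑-+ f g (x ∷ xs) = trans (cong (f x + g x +_) (∑-+ f g xs))
    (solve 4 (λ a b c d → (a :+ b) :+ (c :+ d) := (a :+ c) :+ (b :+ d)) refl
      (f x) (g x) (∑ f xs) (∑ g xs))

  ∑-* : ∀ c (f : A → ℚ) xs → ∑ (λ x → c * f x) xs ≡ c * ∑ f xs
  ∑-* c f []       = sym (*-zeroʳ c)
  ∑-* c f (x ∷ xs) = trans (cong (c * f x +_) (∑-* c f xs)) (sym (*-distribˡ-+ c (f x) (∑ f xs)))

  ∑-const : ∀ c (xs : List A) → ∑ (λ _ → c) xs ≡ ι (length xs) * c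
  ∑-const c []       = sym (*-zeroˡ c)
  ∑-const c (x ∷ xs) = trans (cong (c +_) (∑-const c xs))
    (solve 2 (λ c n → c :+ n :* c := (con 1ℚ :+ n) :* c) refl c (ι (length xs)))

  ∑-nonNeg : ∀ {f : A → ℚ} → (∀ x → 0ℚ ≤ f x) → ∀ xs → 0ℚ ≤ ∑ f xs
  ∑-nonNeg h []       = ≤-refl
  ∑-nonNeg h (x ∷ xs) = 0≤+ (h x) (∑-nonNeg h xs)

  term≤∑ : ∀ {f : A → ℚ} → (∀ x → 0ℚ ≤ f x) → ∀ {x xs} → x ∈ xs → f x ≤ ∑ f xs
  term≤∑ {f} h {xs = _ ∷ xs} (here refl) = a≤a+b (∑-nonNeg h xs)
  term≤∑ {f} h {x} {y ∷ xs} (there x∈xs) = ≤-trans (term≤∑ h x∈xs)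
    (subst (_≤ f y + ∑ f xs) (+-identityˡ (∑ f xs)) (+-monoˡ-≤ (∑ f xs) (h y)))

  ∑-++ : ∀ (f : A → ℚ) xs ys → ∑ f (xs ++ ys) ≡ ∑ f xs + ∑ f ys
  ∑-++ f []       ys = sym (+-identityˡ _)
  ∑-++ f (x ∷ xs) ys = trans (cong (f x +_) (∑-++ f xs ys)) (sym (+-assoc (f x) _ _))

  ∑-map : ∀ {B : Set} (f : A → ℚ) (g : B → A) xs → ∑ f (map g xs) ≡ ∑ (f ∘ g) xs
  ∑-map f g []       = refl
  ∑-map f g (x ∷ xs) = cong (f (g x) +_) (∑-map f g xs)

-- The cube: cancellation, enumeration and point masses

infix 4 _≟_

_≟_ : ∀ {k} (u v : Cube k) → Dec (u ≡ v)
_≟_ = ≡-dec _≟ᵇ_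

xor-cancelˡ : ∀ a {b c} → a xor b ≡ a xor c → b ≡ c
xor-cancelˡ true  = not-injective
xor-cancelˡ false = λ e → e

⊕-cancelˡ : ∀ {k} (v : Cube k) {s t} → v ⊕ s ≡ v ⊕ t → s ≡ t
⊕-cancelˡ []      {[]}    {[]}    e = refl
⊕-cancelˡ (a ∷ v) {b ∷ s} {c ∷ t} e =
  cong₂ _∷_ (xor-cancelˡ a (cong head e)) (⊕-cancelˡ v (∷-injectiveʳ e))

ind : Bool → ℚ
ind true  = 1ℚ
ind false = 0ℚ

allCube-complete : ∀ {k} (v : Cube k) → v ∈ allCube k
allCube-complete []          = here refl
allCube-complete (false ∷ v) = ∈-++⁺ˡ (∈-map⁺ (false ∷_) (allCube-complete v))
allCube-complete (true ∷ v)  =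
  ∈-++⁺ʳ (map (false ∷_) (allCube _)) (∈-map⁺ (true ∷_) (allCube-complete v))

allCube-unique : ∀ k → Unique (allCube k)
allCube-unique zero    = [] ∷ []
allCube-unique (suc k) = ++⁺ (map⁺ ∷-injectiveʳ (allCube-unique k)) (map⁺ ∷-injectiveʳ (allCube-unique k))
  λ { (u∈f , u∈t) → disjoint (∈-map⁻ (false ∷_) u∈f) (∈-map⁻ (true ∷_) u∈t) }
  where
  disjoint : ∀ {u : Cube (suc k)} → ∃ (λ v → v ∈ allCube k × u ≡ false ∷ v) →
             ¬ ∃ (λ v → v ∈ allCube k × u ≡ true ∷ v)
  disjoint (_ , _ , refl) (_ , _ , ())

length-allCube : ∀ k → length (allCube k) ≡ 2 ℕ.^ k
length-allCube zero    = refl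
length-allCube (suc k) = begin
  length (map (false ∷_) (allCube k) ++ map (true ∷_) (allCube k))
    ≡⟨ length-++ (map (false ∷_) (allCube k)) ⟩
  length (map (false ∷_) (allCube k)) ℕ.+ length (map (true ∷_) (allCube k))
    ≡⟨ cong₂ ℕ._+_ (trans (length-map _ (allCube k)) (length-allCube k))
                   (trans (length-map _ (allCube k)) (length-allCube k)) ⟩
  2 ℕ.^ k ℕ.+ 2 ℕ.^ k
    ≡⟨ cong (2 ℕ.^ k ℕ.+_) (sym (ℕ.+-identityʳ _)) ⟩
  2 ℕ.^ suc k ∎
  where open ≡-Reasoning

∑-allCube : ∀ k (f : Cube (suc k) → ℚ) →
  ∑ f (allCube (suc k)) ≡ ∑ (f ∘ (false ∷_)) (allCube k) + ∑ (f ∘ (true ∷_)) (allCube k)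
∑-allCube k f = trans (∑-++ f (map (false ∷_) (allCube k)) _)
  (cong₂ _+_ (∑-map f (false ∷_) (allCube k)) (∑-map f (true ∷_) (allCube k)))

hit : ∀ {k} → Cube k → Cube k → ℚ
hit x u = ind (does (u ≟ x))

∑-0 : ∀ {A : Set} (xs : List A) → ∑ (λ _ → 0ℚ) xs ≡ 0ℚ
∑-0 xs = trans (∑-const 0ℚ xs) (*-zeroʳ (ι (length xs)))

-- Translation by s is a bijection, so exactly one v contributes. In each coordinate one half of the
-- cube misses x altogether and the other half is the same problem one dimension lower.
∑-hit : ∀ k (x s : Cube k) → ∑ (λ v → hit x (v ⊕ s)) (allCube k) ≡ 1ℚ
∑-hit zero    []          []          = refl
∑-hit (suc k) (false ∷ x) (false ∷ s) = trans (∑-allCube k _)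
  (trans (cong₂ _+_ (∑-hit k x s) (∑-0 (allCube k))) (+-identityʳ 1ℚ))
∑-hit (suc k) (true ∷ x)  (true ∷ s)  = trans (∑-allCube k _)
  (trans (cong₂ _+_ (∑-hit k x s) (∑-0 (allCube k))) (+-identityʳ 1ℚ))
∑-hit (suc k) (false ∷ x) (true ∷ s)  = trans (∑-allCube k _)
  (trans (cong₂ _+_ (∑-0 (allCube k)) (∑-hit k x s)) (+-identityˡ 1ℚ))
∑-hit (suc k) (true ∷ x)  (false ∷ s) = trans (∑-allCube k _)
  (trans (cong₂ _+_ (∑-0 (allCube k)) (∑-hit k x s)) (+-identityˡ 1ℚ))

-- Fractional subsets and the effect of deciding one point

-- A fractional subset: the value at v is the probability that v ends up in C, and it is 0 or 1 once
-- v is decided.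
Weighting : ℕ → Set
Weighting k = Cube k → ℚ

-- For distinct shifts the points `v ⊕ s` are distinct, so by independence this product is the
-- probability that v lies in all the translates, and `total` is the expected size of the
-- intersection.
weight : ∀ {k} → Weighting k → List (Cube k) → Cube k → ℚ
weight w []      v = 1ℚ
weight w (s ∷ X) v = w (v ⊕ s) * weight w X v

total : ∀ {k} → Weighting k → List (Cube k) → ℚ
total w X = ∑ (weight w X) (allCube _)

record Bounded {k} (w : Weighting k) : Set where
  field
    lower : ∀ v → 0ℚ ≤ w v
    upper : ∀ v → w v ≤ 1ℚ
open Bounded

weight-nonNeg : ∀ {k} {w : Weighting k} → Bounded w → ∀ X v → 0ℚ ≤ weight w X v
weight-nonNeg b []      v = 0≤1
weight-nonNeg b (s ∷ X) v = 0≤* (lower b (v ⊕ s)) (weight-nonNeg b X v)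

weight≤1 : ∀ {k} {w : Weighting k} → Bounded w → ∀ X v → weight w X v ≤ 1ℚ
weight≤1 b []      v = ≤-refl
weight≤1 b (s ∷ X) v = scale-≤ (lower b (v ⊕ s)) (upper b (v ⊕ s)) 0≤1 (weight≤1 b X v)

decide : ∀ {k} → Weighting k → Cube k → Bool → Weighting k
decide w x c v with v ≟ x
... | yes _ = ind c
... | no  _ = w v

decide-there : ∀ {k} (w : Weighting k) {x v} c → v ≢ x → decide w x c v ≡ w v
decide-there w {x} {v} c v≢x with v ≟ x
... | yes v≡x = contradiction v≡x v≢x
... | no  _   = refl

0≤ind : ∀ c → 0ℚ ≤ ind c
0≤ind true  = 0≤1
0≤ind false = ≤-refl

ind≤1 : ∀ c → ind c ≤ 1ℚ
ind≤1 true  = ≤-refl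
ind≤1 false = 0≤1

decide-bounded : ∀ {k} {w : Weighting k} → Bounded w → ∀ x c → Bounded (decide w x c)
decide-bounded {k} {w} b x c = record { lower = low ; upper = up }
  where
  low : ∀ v → 0ℚ ≤ decide w x c v
  low v with v ≟ x
  ... | yes _ = 0≤ind c
  ... | no  _ = lower b v
  up : ∀ v → decide w x c v ≤ 1ℚ
  up v with v ≟ x
  ... | yes _ = ind≤1 c
  ... | no  _ = upper b v

weight-decide-there : ∀ {k} (w : Weighting k) x c X v → All (λ s → v ⊕ s ≢ x) X →
  weight (decide w x c) X v ≡ weight w X v
weight-decide-there w x c []      v []         = refl
weight-decide-there w x c (s ∷ X) v (ne ∷ nes) =
  cong₂ _*_ (decide-there w c ne) (weight-decide-there w x c X v nes)

weight-decide-mono : ∀ {k} {w : Weighting k} → Bounded w → ∀ x X v →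
  weight (decide w x false) X v ≤ weight (decide w x true) X v
weight-decide-mono b x []      v = ≤-refl
weight-decide-mono {w = w} b x (s ∷ X) v = *-mono₂-≤
  (lower (decide-bounded b x true) (v ⊕ s)) (weight-nonNeg (decide-bounded b x false) X v)
  (mono (v ⊕ s)) (weight-decide-mono b x X v)
  where
  mono : ∀ u → decide w x false u ≤ decide w x true u
  mono u with u ≟ x
  ... | yes _ = 0≤1
  ... | no  _ = ≤-refl

-- Only factors with `v ⊕ s` equal to x change, and all factors lie in [0,1], so each such shift
-- costs at most 1. Summed over v, every shift meets x exactly once, so the total moves by at most
-- the length of X.
weight-decide-Lipschitz : ∀ {k} {w : Weighting k} → Bounded w → ∀ x X v →
  weight (decide w x true) X v ≤ weight (decide w x false) X v + ∑ (λ s → hit x (v ⊕ s)) X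
weight-decide-Lipschitz b x []      v = ≤-reflexive (sym (+-identityʳ 1ℚ))
weight-decide-Lipschitz {w = w} b x (s ∷ X) v
  with v ⊕ s ≟ x | weight-decide-Lipschitz b x X v
-- This hit alone contributes 1, already an upper bound for the whole product, so the induction
-- hypothesis is not consulted.
... | yes _ | _  = begin
  1ℚ * P₁                ≡⟨ *-identityˡ P₁ ⟩
  P₁                     ≤⟨ weight≤1 (decide-bounded b x true) X v ⟩
  1ℚ                     ≤⟨ a≤a+b (∑-nonNeg (λ s → 0≤ind (does (v ⊕ s ≟ x))) X) ⟩
  1ℚ + H                 ≡⟨ solve 2 (λ P H → con 1ℚ :+ H := con 0ℚ :* P :+ (con 1ℚ :+ H)) refl P₀ H ⟩
  0ℚ * P₀ + (1ℚ + H)     ∎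
  where
  open ≤-Reasoning
  P₀ = weight (decide w x false) X v
  P₁ = weight (decide w x true) X v
  H  = ∑ (λ s → hit x (v ⊕ s)) X
... | no  _ | ih = begin
  a * P₁                 ≤⟨ *-monoˡ-≤-nonNeg a {{nonNegative (lower b (v ⊕ s))}} ih ⟩
  a * (P₀ + H)           ≡⟨ *-distribˡ-+ a P₀ H ⟩
  a * P₀ + a * H         ≤⟨ +-monoʳ-≤ (a * P₀) (scale-≤ (lower b (v ⊕ s)) (upper b (v ⊕ s)) 0≤H ≤-refl) ⟩
  a * P₀ + H             ≡⟨ cong (a * P₀ +_) (sym (+-identityˡ H)) ⟩
  a * P₀ + (0ℚ + H)      ∎
  where
  open ≤-Reasoning
  a  = w (v ⊕ s)
  P₀ = weight (decide w x false) X v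
  P₁ = weight (decide w x true) X v
  H  = ∑ (λ s → hit x (v ⊕ s)) X
  0≤H = ∑-nonNeg (λ s → 0≤ind (does (v ⊕ s ≟ x))) X

∑-∑-hit : ∀ {k} (x : Cube k) X → ∑ (λ v → ∑ (λ s → hit x (v ⊕ s)) X) (allCube k) ≡ ι (length X)
∑-∑-hit {k} x []      = ∑-0 (allCube k)
∑-∑-hit {k} x (s ∷ X) = trans (∑-+ _ _ (allCube k)) (cong₂ _+_ (∑-hit k x s) (∑-∑-hit x X))

module _ {k} {w : Weighting k} (b : Bounded w) (x : Cube k) (X : List (Cube k)) where

  total-decide-mono : total (decide w x false) X ≤ total (decide w x true) X
  total-decide-mono = ∑-mono (weight-decide-mono b x X) (allCube k)

  total-decide-Lipschitz : total (decide w x true) X ≤ total (decide w x false) X + ι (length X)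
  total-decide-Lipschitz = begin
    total (decide w x true) X
      ≤⟨ ∑-mono (weight-decide-Lipschitz b x X) (allCube k) ⟩
    ∑ (λ v → weight (decide w x false) X v + ∑ (λ s → hit x (v ⊕ s)) X) (allCube k)
      ≡⟨ ∑-+ _ _ (allCube k) ⟩
    total (decide w x false) X + ∑ (λ v → ∑ (λ s → hit x (v ⊕ s)) X) (allCube k)
      ≡⟨ cong (total (decide w x false) X +_) (∑-∑-hit x X) ⟩
    total (decide w x false) X + ι (length X) ∎
    where open ≤-Reasoning

-- bigInter C (s ∷ X) v unfolds to C (v ⊕ s) ∧ bigInter C X v only because the local recursion in
-- bigInter ignores the outer list, so Agda's conversion check disregards that parameter.
weight-ind : ∀ {k} (C : Subset2 k) X v → ind (bigInter C X v) ≡ weight (ind ∘ C) X v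
weight-ind C []      v = refl
weight-ind C (s ∷ X) v = trans (ind-∧ (C (v ⊕ s)) (bigInter C X v)) (cong (ind (C (v ⊕ s)) *_) (weight-ind C X v))
  where
  ind-∧ : ∀ a b → ind (a ∧ b) ≡ ind a * ind b
  ind-∧ true  b = sym (*-identityˡ (ind b))
  ind-∧ false b = sym (*-zeroˡ (ind b))

ι-count : ∀ {A : Set} (f : A → Bool) xs → ι (length (filter (λ x → T? (f x)) xs)) ≡ ∑ (ind ∘ f) xs
ι-count f []       = refl
ι-count f (x ∷ xs) with f x
... | true  = cong (1ℚ +_) (ι-count f xs)
... | false = trans (ι-count f xs) (sym (+-identityˡ _))

ι-card : ∀ {k} (C : Subset2 k) X → ι (card (bigInter C X)) ≡ total (ind ∘ C) X
ι-card {k} C X = trans (ι-count (bigInter C X) (allCube k)) (∑-cong (weight-ind C X) (allCube k))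

-- Conditional expectations: choosing C point by point

module Greedy {p : ℚ} (0≤p : 0ℚ ≤ p) (p≤1 : p ≤ 1ℚ) {k : ℕ} (M r : ℕ) where

  open Step p 0≤p p≤1

  -- For distinct shifts at most one factor sits at x, so the product is affine in the value there
  -- and averaging over the two decisions restores p. A repeated shift could bring in that value
  -- squared.
  weight-mean : ∀ (w : Weighting k) x → w x ≡ p → ∀ {X} → Unique X → ∀ v →
    mean (weight (decide w x true) X v) (weight (decide w x false) X v) ≡ weight w X v
  weight-mean w x wx≡p [] v =
    solve 1 (λ p → p :* con 1ℚ :+ (con 1ℚ :- p) :* con 1ℚ := con 1ℚ) refl p
  weight-mean w x wx≡p {s ∷ X} (s∉X ∷ uniq) v with v ⊕ s ≟ x
  ... | yes v⊕s≡x = begin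
    mean (1ℚ * weight (decide w x true) X v) (0ℚ * weight (decide w x false) X v)
      ≡⟨ cong₂ (λ a b → mean (1ℚ * a) (0ℚ * b))
           (weight-decide-there w x true X v misses) (weight-decide-there w x false X v misses) ⟩
    mean (1ℚ * weight w X v) (0ℚ * weight w X v)
      ≡⟨ solve 2 (λ p R → p :* (con 1ℚ :* R) :+ (con 1ℚ :- p) :* (con 0ℚ :* R) := p :* R) refl
           p (weight w X v) ⟩
    p * weight w X v
      ≡⟨ cong (_* weight w X v) (sym (trans (cong w v⊕s≡x) wx≡p)) ⟩
    w (v ⊕ s) * weight w X v ∎
    where
    open ≡-Reasoning
    misses : All (λ t → v ⊕ t ≢ x) X
    misses = All.map (λ s≢t v⊕t≡x → s≢t (⊕-cancelˡ v (trans v⊕s≡x (sym v⊕t≡x)))) s∉X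
  ... | no _ = trans
    (solve 4 (λ p a x y → p :* (a :* x) :+ (con 1ℚ :- p) :* (a :* y) :=
       a :* (p :* x :+ (con 1ℚ :- p) :* y)) refl p (w (v ⊕ s))
       (weight (decide w x true) X v) (weight (decide w x false) X v))
    (cong (w (v ⊕ s) *_) (weight-mean w x wx≡p uniq v))

  ∑-mean : ∀ {A : Set} (f g : A → ℚ) xs → mean (∑ f xs) (∑ g xs) ≡ ∑ (λ x → mean (f x) (g x)) xs
  ∑-mean f g xs = sym (trans (∑-+ _ _ xs) (cong₂ _+_ (∑-* p f xs) (∑-* q g xs)))

  total-mean : ∀ (w : Weighting k) x → w x ≡ p → ∀ {X} → Unique X →
    mean (total (decide w x true) X) (total (decide w x false) X) ≡ total w X
  total-mean w x wx≡p uniq = trans (∑-mean _ _ (allCube k)) (∑-cong (weight-mean w x wx≡p uniq) (allCube k))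

  -- One decision moves the total of a short list by at most M, so μ bounds the squared move; L is
  -- the allowance that each decision uses up.
  μ L : ℚ
  μ = ι M * ι M
  L = growth r μ

  0≤μ : 0ℚ ≤ μ
  0≤μ = 0≤square (ι M)

  0≤growth : ∀ r → 0ℚ ≤ growth r μ
  0≤growth zero    = 0≤μ
  0≤growth (suc r) = 0≤+ (0≤growth r) (0≤* (0≤* (ι-nonNeg r) (0≤* 0≤4 0≤μ)) (^-nonNeg r 0≤2))
    where 0≤4 = 0≤* 0≤2 0≤2

  0≤L : 0ℚ ≤ L
  0≤L = 0≤growth r

  Short : List (Cube k) → Set
  Short X = Unique X × length X ℕ.≤ M

  module _ (target : List (Cube k) → ℚ) where

    deviation : Weighting k → List (Cube k) → ℚ
    deviation w X = total w X - target X

    -- t counts the points still to be decided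
    energy : ℕ → Weighting k → List (Cube k) → ℚ
    energy t w X = (deviation w X * deviation w X + ι t * L) ^ℚ r

    energy-nonNeg : ∀ t w X → 0ℚ ≤ energy t w X
    energy-nonNeg t w X = ^-nonNeg r (0≤+ (0≤square (deviation w X)) (0≤* (ι-nonNeg t) 0≤L))

    -- The deviation is a martingale with steps of size at most M, so `power-step` applies with Y
    -- equal to `ι t * L`. The extra L it demands is the one set aside for x, turning t into t + 1.
    energy-step : ∀ t {w} → Bounded w → ∀ x → w x ≡ p → ∀ {X} → Short X →
      mean (energy t (decide w x true) X) (energy t (decide w x false) X) ≤ energy (suc t) w X
    energy-step t {w} b x wx≡p {X} (uniq , ∣X∣≤M) = subst
      (mean (energy t (decide w x true) X) (energy t (decide w x false) X) ≤_)
      (cong (_^ℚ r) (trans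
        (cong (λ d → d * d + ι t * L + L) mean-deviation)
        (solve 3 (λ d n L → d :+ n :* L :+ L := d :+ (con 1ℚ :+ n) :* L) refl
          (deviation w X * deviation w X) (ι t) L)))
      (power-step d₁ d₀ (ι t * L) μ (0≤* (ι-nonNeg t) 0≤L) 0≤μ small r)
      where
      d₁ = deviation (decide w x true) X
      d₀ = deviation (decide w x false) X
      t₁ = total (decide w x true) X
      t₀ = total (decide w x false) X
      mean-deviation : mean d₁ d₀ ≡ deviation w X
      mean-deviation = trans
        (solve 4 (λ p a b c → p :* (a :- c) :+ (con 1ℚ :- p) :* (b :- c) :=
          p :* a :+ (con 1ℚ :- p) :* b :- c) refl p t₁ t₀ (target X))
        (cong (_- target X) (total-mean w x wx≡p uniq))
      d₁-d₀ : t₁ - t₀ ≡ d₁ - d₀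
      d₁-d₀ = solve 3 (λ a b c → a :- b := (a :- c) :- (b :- c)) refl t₁ t₀ (target X)
      0≤d₁-d₀ : 0ℚ ≤ d₁ - d₀
      0≤d₁-d₀ = subst (0ℚ ≤_) d₁-d₀ (a≤b⇒0≤b-a (total-decide-mono b x X))
      d₁-d₀≤M : d₁ - d₀ ≤ ι M
      d₁-d₀≤M = ≤-trans (subst₂ _≤_ d₁-d₀
        (solve 2 (λ a b → a :+ b :- a := b) refl t₀ (ι (length X)))
        (+-monoˡ-≤ (- t₀) (total-decide-Lipschitz b x X))) (ι-mono-≤ ∣X∣≤M)
      small : (d₁ - d₀) * (d₁ - d₀) ≤ μ
      small = *-mono₂-≤ (ι-nonNeg M) 0≤d₁-d₀ d₁-d₀≤M d₁-d₀≤M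

    mean-≤⇒≤ : ∀ {a b z} → mean a b ≤ z → a ≤ z ⊎ b ≤ z
    mean-≤⇒≤ {a} {b} {z} h with ≤-total a b
    ... | inj₁ a≤b = inj₁ (≤-trans (subst (_≤ mean a b)
      (solve 2 (λ p a → p :* a :+ (con 1ℚ :- p) :* a := a) refl p a)
      (+-monoʳ-≤ (p * a) (*-monoˡ-≤-nonNeg q {{nonNegative 0≤q}} a≤b))) h)
    ... | inj₂ b≤a = inj₂ (≤-trans (subst (_≤ mean a b)
      (solve 2 (λ p a → p :* a :+ (con 1ℚ :- p) :* a := a) refl p b)
      (+-monoˡ-≤ (q * b) (*-monoˡ-≤-nonNeg p {{nonNegative 0≤p}} b≤a))) h)

    module _ {Xs : List (List (Cube k))} (short : All Short Xs) where

      potential : ℕ → Weighting k → ℚ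
      potential t w = ∑ (energy t w) Xs

      -- One choice of c has to serve all lists at once, so the mean inequality is summed over `Xs`
      -- first and the better of the two decisions is taken afterwards.
      potential-step : ∀ t {w} → Bounded w → ∀ x → w x ≡ p →
        ∃ λ c → potential t (decide w x c) ≤ potential (suc t) w
      potential-step t {w} b x wx≡p with mean-≤⇒≤ (subst (_≤ potential (suc t) w)
        (sym (∑-mean (energy t (decide w x true)) (energy t (decide w x false)) Xs))
        (∑-mono-All (All.map (energy-step t b x wx≡p) short)))
      ... | inj₁ h = true , h
      ... | inj₂ h = false , h

      -- Invariant: every point is decided or still listed, and listed points still carry p.
      -- Uniqueness of the list keeps a decision at x from disturbing the later points.
      decide-all : ∀ {xs} → Unique xs → ∀ {w} → Bounded w → All (λ x → w x ≡ p) xs →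
        (∀ v → (∃ λ c → w v ≡ ind c) ⊎ v ∈ xs) →
        ∃ λ (C : Subset2 k) → potential 0 (ind ∘ C) ≤ potential (length xs) w
      decide-all [] {w} b _ decided = C , ≤-reflexive (∑-cong same Xs)
        where
        value : ∀ v → ∃ λ c → w v ≡ ind c
        -- Nothing is listed any more, so each weight is 0 or 1 and the weighting is the indicator
        -- of an actual set.
        value v with decided v
        ... | inj₁ d = d
        C = proj₁ ∘ value
        weight-same : ∀ X v → weight (ind ∘ C) X v ≡ weight w X v
        weight-same []      v = refl
        weight-same (s ∷ X) v = cong₂ _*_ (sym (proj₂ (value (v ⊕ s)))) (weight-same X v)
        same : ∀ X → energy 0 (ind ∘ C) X ≡ energy 0 w X
        same X = cong (λ a → ((a - target X) * (a - target X) + 0ℚ * L) ^ℚ r)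
          (∑-cong (weight-same X) (allCube k))
      decide-all {x ∷ xs} (x∉xs ∷ uniq) {w} b (wx≡p ∷ undecided) decided
        with potential-step (length xs) b x wx≡p
      ... | c , descent
        with decide-all uniq (decide-bounded b x c) undecided′ decided′
        where
        undecided′ : All (λ y → decide w x c y ≡ p) xs
        undecided′ = All.zipWith
          (λ (x≢y , wy≡p) → trans (decide-there w c (x≢y ∘ sym)) wy≡p) (x∉xs , undecided)
        decided′ : ∀ v → (∃ λ c′ → decide w x c v ≡ ind c′) ⊎ v ∈ xs
        decided′ v with v ≟ x | decided v
        ... | yes _   | _                    = inj₁ (c , refl)
        ... | no v≢x  | inj₁ d               = inj₁ d
        ... | no v≢x  | inj₂ (here v≡x)      = contradiction v≡x v≢x
        ... | no v≢x  | inj₂ (there v∈xs)    = inj₂ v∈xs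
      ... | C , bound = C , ≤-trans bound descent

-- Arithmetic of the embedding and the Archimedean property

ι-+ : ∀ m n → ι (m ℕ.+ n) ≡ ι m + ι n
ι-+ zero    n = sym (+-identityˡ (ι n))
ι-+ (suc m) n = trans (cong (1ℚ +_) (ι-+ m n)) (sym (+-assoc 1ℚ (ι m) (ι n)))

ι-* : ∀ m n → ι (m ℕ.* n) ≡ ι m * ι n
ι-* zero    n = sym (*-zeroˡ (ι n))
ι-* (suc m) n = trans (ι-+ n (m ℕ.* n)) (trans (cong (ι n +_) (ι-* m n))
  (solve 2 (λ m n → n :+ m :* n := (con 1ℚ :+ m) :* n) refl (ι m) (ι n)))

ι≡mkℚ : ∀ n → ι n ≡ mkℚ (ℤ.+ n) 0 (coprime-sym (1-coprimeTo n))
ι≡mkℚ zero    = refl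
ι≡mkℚ (suc n) = trans (cong (1ℚ +_) (ι≡mkℚ n))
  (trans (cong (_/ 1) (cong (λ z → ℤ.+ 1 ℤ.+ z) (ℤ.*-identityʳ (ℤ.+ n))))
         (normalize-coprime (coprime-sym (1-coprimeTo (suc n)))))

-- Denominators are at least 1, so a nonnegative numerator bounds its fraction; negative fractions
-- are below 0.
≤ι : ∀ z → ∃ λ n → z ≤ ι n
≤ι z@(mkℚ (ℤ.+ a) d-1 _) = a , subst (z ≤_) (sym (ι≡mkℚ a)) (*≤* (ℤ.*-monoˡ-≤-nonNeg (ℤ.+ a) (ℤ.+≤+ (ℕ.s≤s ℕ.z≤n))))
≤ι z@(mkℚ ℤ.-[1+ a ] d-1 _) = 0 , *≤* ℤ.-≤+

archimedean : ∀ b {e} → 0ℚ < e → ∃ λ n → b ≤ ι n * e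
archimedean b {e} 0<e with ≤ι (b * (1/ e) {{pos⇒nonZero e {{positive 0<e}}}})
... | n , h = n , subst (_≤ ι n * e)
  (trans (*-assoc b _ e) (trans (cong (b *_) (*-inverseˡ e {{pos⇒nonZero e {{positive 0<e}}}})) (*-identityʳ b)))
  (*-monoʳ-≤-nonNeg e {{nonNegative (<⇒≤ 0<e)}} h)

-- Checked among unnormalised rationals, where no gcd gets in the way.
/-*-ι : ∀ a n .{{_ : ℕ.NonZero n}} → (ℤ.+ a) / n * ι n ≡ ι a
/-*-ι a (suc n-1) = toℚᵘ-injective (begin
  toℚᵘ ((ℤ.+ a) / suc n-1 * ι (suc n-1))
    ≈⟨ toℚᵘ-homo-* ((ℤ.+ a) / suc n-1) (ι (suc n-1)) ⟩
  toℚᵘ ((ℤ.+ a) / suc n-1) ℚᵘ.* toℚᵘ (ι (suc n-1))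
    ≈⟨ ℚᵘ.*-cong (toℚᵘ-fromℚᵘ (mkℚᵘ (ℤ.+ a) n-1)) (toℚᵘ-cong (ι≡mkℚ (suc n-1))) ⟩
  mkℚᵘ (ℤ.+ a) n-1 ℚᵘ.* mkℚᵘ (ℤ.+ suc n-1) 0
    ≈⟨ ℚᵘ.*≡* (ℤ.*-assoc (ℤ.+ a) (ℤ.+ suc n-1) (ℤ.+ 1)) ⟩
  mkℚᵘ (ℤ.+ a) 0
    ≈⟨ toℚᵘ-cong (sym (ι≡mkℚ a)) ⟩
  toℚᵘ (ι a) ∎)
  where open ℚᵘ.≃-Reasoning

-- Counting the short lists of shifts

-- Contains all lists of length at most j, repetitions included, which keeps the count simple;
-- `low-energy` filters out those that are not `Short`.
sequences : ∀ k → ℕ → List (List (Cube k))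
sequences k zero    = [] ∷ []
sequences k (suc j) = [] ∷ cartesianProductWith _∷_ (allCube k) (sequences k j)

sequences-complete : ∀ {k} j (X : List (Cube k)) → length X ℕ.≤ j → X ∈ sequences k j
sequences-complete zero    []      _             = here refl
sequences-complete (suc j) []      _             = here refl
sequences-complete (suc j) (s ∷ X) (ℕ.s≤s ∣X∣≤j) =
  there (∈-cartesianProductWith⁺ _∷_ (allCube-complete s) (sequences-complete j X ∣X∣≤j))

length-cartesianProductWith : ∀ {A B C : Set} (f : A → B → C) xs ys →
  length (cartesianProductWith f xs ys) ≡ length xs ℕ.* length ys
length-cartesianProductWith f []       ys = refl
length-cartesianProductWith f (x ∷ xs) ys = trans (length-++ (map (f x) ys))
  (cong₂ ℕ._+_ (length-map (f x) ys) (length-cartesianProductWith f xs ys))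

suc-n≤2^n : ∀ n → suc n ℕ.≤ 2 ℕ.^ n
suc-n≤2^n zero    = ℕ.≤-refl
suc-n≤2^n (suc n) = ℕ.+-mono-≤ (ℕ.m^n>0 2 n) (ℕ.≤-trans (suc-n≤2^n n) (ℕ.m≤m+n _ 0))

module _ (k : ℕ) where

  size : ℚ
  size = ι (2 ℕ.^ k)

  1≤size : 1ℚ ≤ size
  1≤size = ι-mono-≤ (ℕ.m^n>0 2 k)

  0≤size : 0ℚ ≤ size
  0≤size = ≤-trans 0≤1 1≤size

  1≤^ : ∀ j {a} → 1ℚ ≤ a → 1ℚ ≤ a ^ℚ j
  1≤^ zero    _   = ≤-refl
  1≤^ (suc j) 1≤a = *-mono₂-≤ (≤-trans 0≤1 1≤a) 0≤1 1≤a (1≤^ j 1≤a)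

  length-sequences : ∀ j → ι (length (sequences k j)) ≤ (2ℚ * size) ^ℚ j
  length-sequences zero    = ≤-refl
  length-sequences (suc j) = begin
    1ℚ + ι (length (cartesianProductWith _∷_ (allCube k) (sequences k j)))
      ≡⟨ cong (1ℚ +_) (trans (cong ι (trans
           (length-cartesianProductWith _∷_ (allCube k) (sequences k j))
           (cong (ℕ._* length (sequences k j)) (length-allCube k)))) (ι-* (2 ℕ.^ k) _)) ⟩
    1ℚ + size * ι (length (sequences k j))
      -- The empty list counts 1, absorbed by a second copy of `size * P`; this is the origin of the
      -- factor 2.
      ≤⟨ +-mono-≤ (*-mono₂-≤ 0≤size 0≤1 1≤size (1≤^ j (≤-trans 1≤size size≤2size)))
                  (*-monoˡ-≤-nonNeg size {{nonNegative 0≤size}} (length-sequences j)) ⟩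
    size * P + size * P
      ≡⟨ solve 2 (λ s P → s :* P :+ s :* P := con 2ℚ :* s :* P) refl size P ⟩
    2ℚ * size * P ∎
    where
    open ≤-Reasoning
    P = (2ℚ * size) ^ℚ j
    size≤2size : size ≤ 2ℚ * size
    size≤2size = subst (size ≤_) (solve 1 (λ s → s :+ s := con 2ℚ :* s) refl size) (a≤a+b 0≤size)

-- Initial energy against the cost of a large deviation

density-*-size : ∀ {k} (A : Subset2 k) → density A * size k ≡ ι (card A)
density-*-size {k} A = /-*-ι (card A) (2 ℕ.^ k) {{ℕ.m^n≢0 2 k}}

weight-const : ∀ {k} p (X : List (Cube k)) v → weight (λ _ → p) X v ≡ p ^ℚ length X
weight-const p []      v = refl
weight-const p (s ∷ X) v = cong (p *_) (weight-const p X v)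

total-const : ∀ {k} p (X : List (Cube k)) → total (λ _ → p) X ≡ size k * p ^ℚ length X
total-const {k} p X = trans (∑-cong (weight-const p X) (allCube k))
  (trans (∑-const _ (allCube k)) (cong (λ n → ι n * p ^ℚ length X) (length-allCube k)))

module _ {p : ℚ} (0≤p : 0ℚ ≤ p) (p≤1 : p ≤ 1ℚ) (k M r : ℕ) where

  open Greedy 0≤p p≤1 {k} M r

  expected : List (Cube k) → ℚ
  expected X = size k * p ^ℚ length X

  -- Under the constant weighting p every deviation vanishes and only the allowance N L remains,
  -- with N the size of the cube. Energies are nonnegative, so the bound on the final sum holds for
  -- each list in it.
  low-energy : ∃ λ (C : Subset2 k) → ∀ X → Short X →
    energy expected 0 (ind ∘ C) X ≤ (2ℚ * size k) ^ℚ M * (size k * L) ^ℚ r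
  low-energy = C , λ X short → ≤-trans
    (term≤∑ (energy-nonNeg expected 0 (ind ∘ C))
      (∈-filter⁺ short? (sequences-complete M X (proj₂ short)) short))
    (≤-trans C-good initial)
    where
    short? : (X : List (Cube k)) → Dec (Short X)
    short? X = DecUnique.unique? _≟_ X ×-dec (length X ℕ.≤? M)
    Xs = filter short? (sequences k M)
    found = decide-all expected (all-filter short? (sequences k M)) (allCube-unique k)
      {λ _ → p} (record { lower = λ _ → 0≤p ; upper = λ _ → p≤1 })
      (All.universal (λ _ → refl) (allCube k)) (λ v → inj₂ (allCube-complete v))
    C = proj₁ found
    C-good = proj₂ found
    initial-energy : ∀ X → energy expected (length (allCube k)) (λ _ → p) X ≡ (size k * L) ^ℚ r
    initial-energy X = cong (_^ℚ r) (trans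
      (cong₂ (λ t n → (t - expected X) * (t - expected X) + ι n * L)
        (total-const p X) (length-allCube k))
      (solve 2 (λ e y → (e :- e) :* (e :- e) :+ y := y) refl (expected X) (size k * L)))
    initial : ∑ (energy expected (length (allCube k)) (λ _ → p)) Xs ≤
              (2ℚ * size k) ^ℚ M * (size k * L) ^ℚ r
    initial = begin
      ∑ (energy expected (length (allCube k)) (λ _ → p)) Xs
        ≡⟨ trans (∑-cong initial-energy Xs) (∑-const _ Xs) ⟩
      ι (length Xs) * (size k * L) ^ℚ r
        ≤⟨ *-monoʳ-≤-nonNeg _ {{nonNegative (^-nonNeg r (0≤* (0≤size k) 0≤L))}}
             (≤-trans (ι-mono-≤ (length-filter short? (sequences k M))) (length-sequences k M)) ⟩
      (2ℚ * size k) ^ℚ M * (size k * L) ^ℚ r ∎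
      where open ≤-Reasoning

module _ {p δ : ℚ} (0≤p : 0ℚ ≤ p) (p≤1 : p ≤ 1ℚ) (0<δ : 0ℚ < δ) (M k : ℕ) where

  open Greedy 0≤p p≤1 {k} M (suc M)

  private
    r = suc M
    N = size k

  -- The energy is at least (δN)^(2r), while the bound on it grows like N^(M+r). With r = M + 1
  -- cancelling N^(M+r) leaves exactly one factor N on the left, against a right-hand side that does
  -- not depend on k.
  large-deviation-cost : ∀ C X → δ ≤ ∣ density (bigInter C X) - p ^ℚ length X ∣ →
    energy (expected 0≤p p≤1 k M r) 0 (ind ∘ C) X ≤ (2ℚ * N) ^ℚ M * (N * L) ^ℚ r →
    (δ * δ) ^ℚ r * N ≤ 2ℚ ^ℚ M * L ^ℚ r
  large-deviation-cost C X δ≤∣d∣ low = *-cancelˡ-≤-pos (N ^ℚ M * N ^ℚ r)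
    {{positive (0<* (^-pos M 0<N) (^-pos r 0<N))}} (begin
    N ^ℚ M * N ^ℚ r * (e * N)
      ≡⟨ solve 3 (λ x N e → x :* (N :* x) :* (e :* N) := e :* ((N :* x) :* (N :* x))) refl (N ^ℚ M) N e ⟩
    e * (N ^ℚ r * N ^ℚ r)
      ≡⟨ cong (e *_) (sym (^-distrib-* r N N)) ⟩
    e * (N * N) ^ℚ r
      ≡⟨ sym (^-distrib-* r (δ * δ) (N * N)) ⟩
    (δ * δ * (N * N)) ^ℚ r
      ≤⟨ ^-mono-≤ r (0≤* (0≤square δ) (0≤square N)) square≤ ⟩
    energy (expected 0≤p p≤1 k M r) 0 (ind ∘ C) X
      ≤⟨ low ⟩
    (2ℚ * N) ^ℚ M * (N * L) ^ℚ r
      ≡⟨ cong₂ _*_ (^-distrib-* M 2ℚ N) (^-distrib-* r N L) ⟩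
    2ℚ ^ℚ M * N ^ℚ M * (N ^ℚ r * L ^ℚ r)
      ≡⟨ solve 4 (λ a b c d → a :* b :* (c :* d) := b :* c :* (a :* d)) refl
           (2ℚ ^ℚ M) (N ^ℚ M) (N ^ℚ r) (L ^ℚ r) ⟩
    N ^ℚ M * N ^ℚ r * (2ℚ ^ℚ M * L ^ℚ r) ∎)
    where
    open ≤-Reasoning
    e = (δ * δ) ^ℚ r
    0<N : 0ℚ < N
    0<N = <-≤-trans (positive⁻¹ 1ℚ) (1≤size k)
    D = deviation (expected 0≤p p≤1 k M r) (ind ∘ C) X
    d = density (bigInter C X) - p ^ℚ length X
    d*N≡D : d * N ≡ D
    d*N≡D = trans
      (solve 3 (λ a b N → (a :- b) :* N := a :* N :- N :* b) refl
        (density (bigInter C X)) (p ^ℚ length X) N)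
      (cong (_- N * p ^ℚ length X) (trans (density-*-size (bigInter C X)) (ι-card C X)))
    square≤ : δ * δ * (N * N) ≤ D * D + 0ℚ * L
    square≤ = begin
      δ * δ * (N * N)
        ≤⟨ *-monoʳ-≤-nonNeg (N * N) {{nonNegative (0≤square N)}}
             (*-mono₂-≤ (0≤∣p∣ d) (<⇒≤ 0<δ) δ≤∣d∣ δ≤∣d∣) ⟩
      ∣ d ∣ * ∣ d ∣ * (N * N)
        ≡⟨ cong (_* (N * N)) (∣a∣*∣a∣≡a*a d) ⟩
      d * d * (N * N)
        ≡⟨ solve 3 (λ d N L → d :* d :* (N :* N) := (d :* N) :* (d :* N) :+ con 0ℚ :* L) refl d N L ⟩
      d * N * (d * N) + 0ℚ * L
        ≡⟨ cong (λ D → D * D + 0ℚ * L) d*N≡D ⟩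
      D * D + 0ℚ * L ∎

-- Choice of the threshold

exists-quasirandom-subset : (M : ℕ) {p δ : ℚ} → 0ℚ ≤ p → p ≤ 1ℚ → 0ℚ < δ →
  ∃ λ n → ∀ k → n ℕ.< k → ∃ λ (C : Subset2 k) →
    ∀ X → Unique X → length X ℕ.≤ M → ∣ density (bigInter C X) - p ^ℚ length X ∣ < δ
exists-quasirandom-subset M {p} {δ} 0≤p p≤1 0<δ = n , λ k n<k →
  let C , low = low-energy 0≤p p≤1 k M (suc M) in
  C , λ X uniq ∣X∣≤M → close k n<k C X (low X (uniq , ∣X∣≤M))
  where
  L = growth (suc M) (ι M * ι M)
  e = (δ * δ) ^ℚ suc M
  0<e : 0ℚ < e
  0<e = ^-pos (suc M) (0<* 0<δ 0<δ)
  large : ∃ λ n → 2ℚ ^ℚ M * L ^ℚ suc M ≤ ι n * e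
  -- This fixes n: for k > n the cube has more than n points, so `e * size k` exceeds `ι n * e`, and
  -- a deviation of δ or more contradicts `large-deviation-cost`.
  large = archimedean (2ℚ ^ℚ M * L ^ℚ suc M) 0<e
  n = proj₁ large
  ιn<size : ∀ k → n ℕ.< k → ι n < size k
  ιn<size k n<k = <-≤-trans
    (subst (_< 1ℚ + ι n) (+-identityˡ (ι n)) (+-monoˡ-< (ι n) (positive⁻¹ 1ℚ)))
    (ι-mono-≤ (ℕ.≤-trans n<k (ℕ.≤-trans (ℕ.n≤1+n k) (suc-n≤2^n k))))
  close : ∀ k → n ℕ.< k → ∀ (C : Subset2 k) X →
    Greedy.energy 0≤p p≤1 M (suc M) (expected 0≤p p≤1 k M (suc M)) 0 (ind ∘ C) X ≤
      (2ℚ * size k) ^ℚ M * (size k * L) ^ℚ suc M →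
    ∣ density (bigInter C X) - p ^ℚ length X ∣ < δ
  close k n<k C X low with ∣ density (bigInter C X) - p ^ℚ length X ∣ <? δ
  ... | yes h = h
  ... | no ¬h = contradiction
    (≤-trans (large-deviation-cost 0≤p p≤1 0<δ M k C X (≮⇒≥ ¬h) low) (proj₂ large))
    (λ h → <-irrefl refl (<-≤-trans (subst (_< e * size k) (*-comm e (ι n))
      (*-monoʳ-<-pos e {{positive 0<e}} (ιn<size k n<k))) h))

-- Two-sided bounds and the theorem

a≤∣a∣ : ∀ a → a ≤ ∣ a ∣
a≤∣a∣ a with ≤-total 0ℚ a
... | inj₁ 0≤a = ≤-reflexive (sym (0≤p⇒∣p∣≡p 0≤a))
... | inj₂ a≤0 = ≤-trans a≤0 (0≤∣p∣ a)

∣a-b∣<c⇒bounds : ∀ {a b c} → ∣ a - b ∣ < c → (a ≤ b + c) × (b - c ≤ a)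
∣a-b∣<c⇒bounds {a} {b} {c} h =
  subst (_≤ b + c) (solve 2 (λ a b → b :+ (a :- b) := a) refl a b)
    (+-monoʳ-≤ b (≤-trans (a≤∣a∣ (a - b)) (<⇒≤ h))) ,
  subst₂ _≤_ (solve 3 (λ a b c → (:- (a :- b)) :+ (a :- c) := b :- c) refl a b c)
    (solve 2 (λ a c → c :+ (a :- c) := a) refl a c)
    (+-monoˡ-≤ (a - c) (≤-trans (subst (- (a - b) ≤_) (∣-p∣≡∣p∣ (a - b)) (a≤∣a∣ (- (a - b)))) (<⇒≤ h)))

-- Translation by the zero vector changes nothing, so the bounds on the density of C itself become
-- the case of this one-element list.
density-bigInter-0 : ∀ {k} (C : Subset2 k) → density (bigInter C (replicate k false ∷ [])) ≡ density C
density-bigInter-0 {k} C = cong (λ n → ((ℤ.+ n) / (2 ℕ.^ k)) {{ℕ.m^n≢0 2 k}}) (cong length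
  (filter-≐ (λ v → T? (bigInter C (replicate k false ∷ []) v)) (λ v → T? (C v))
    ((λ {v} → subst T (same v)) , (λ {v} → subst T (sym (same v)))) (allCube k)))
  where
  same : ∀ v → bigInter C (replicate k false ∷ []) v ≡ C v
  same v = trans (∧-identityʳ (C (v ⊕ replicate k false))) (cong C (zipWith-identityʳ xor-identityʳ v))

theorem3p3 : (m : ℕ) (ε δ : ℚ) → 0ℚ < δ → δ < ε → ε < 1ℚ →
    ∃ λ (n : ℕ) → ∀ (k : ℕ) → n ℕ.< k →
    ∃ λ (C : Subset2 k) →
    (density C ≤ (1ℚ - ε) + δ) × ((1ℚ - ε) - δ ≤ density C) ×
    (∀ (X : List (Cube k)) → Unique X → length X ℕ.≤ m →
    ∣ density (bigInter C X) - ((1ℚ - ε) ^ℚ length X) ∣ < δ)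
theorem3p3 m ε δ 0<δ δ<ε ε<1 = n , λ k n<k →
  let C , close = good k n<k
      upper , lower = ∣a-b∣<c⇒bounds (subst₂ (λ a b → ∣ a - b ∣ < δ) (density-bigInter-0 C)
        (*-identityʳ (1ℚ - ε)) (close (replicate k false ∷ []) ([] ∷ []) (ℕ.s≤s ℕ.z≤n)))
  in C , upper , lower , λ X uniq ∣X∣≤m → close X uniq (ℕ.m≤n⇒m≤1+n ∣X∣≤m)
  where
  0≤1-ε : 0ℚ ≤ 1ℚ - ε
  0≤1-ε = a≤b⇒0≤b-a (<⇒≤ ε<1)
  1-ε≤1 : 1ℚ - ε ≤ 1ℚ
  1-ε≤1 = 0≤b-a⇒a≤b (subst (0ℚ ≤_) (solve 1 (λ e → e := con 1ℚ :- (con 1ℚ :- e)) refl ε)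
    (<⇒≤ (<-trans 0<δ δ<ε)))
  -- suc m: the case X = {0}, needed for the density of C itself, must be covered even if m = 0.
  family = exists-quasirandom-subset (suc m) 0≤1-ε 1-ε≤1 0<δ
  n = proj₁ family
  good = proj₂ family
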